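{- Let $\mathcal{P}$ be a reliable graph property and let $G$ be a graph. Then $G$ has an induced subgraph $G'$ such that $\chi_{\rm DP}(G':\mathcal{P})=\chi_{\rm DP}(G:\mathcal{P})$ and $G'$ is $(\mathcal{P},\chi_{\rm DP})$-critical.
   Context: Graphs are finite, undirected, may have multiple edges, no loops. $\mu_G(u,v)$ is the number of edges joining $u$ and $v$. A cover of $G$ is a pair $(X,H)$ where $H$ is a graph and $X$ assigns to each $v\in V(G)$ a set $X_v\subseteq V(H)$ such that the sets $X_v$ are pairwise disjoint, $V(H)=\bigcup_v X_v$, each $X_v$ is independent in $H$, and for distinct $u,v\in V(G)$ the set $E_H(X_u,X_v)$ of edges of $H$ between $X_u$ and $X_v$ is the union of $\mu_G(u,v)$ (possibly empty) matchings of $H$. It is a $k$-cover if $|X_v|\ge k$ for all $v$. A transversal of $(X,H)$ is a set $T\subseteq V(H)$ with $|T\cap X_v|=1$ for all $v\in V(G)$. A graph property is a class of graphs closed under isomorphism. It is non-trivial if it contains a non-empty graph but not all graphs; hereditary if closed under induced subgraphs; additive if closed under disjoint unions; reliable if non-trivial, hereditary and additive. A $\mathcal{P}$-transversal of $(X,H)$ is a transversal $T$ with $H[T]\in\mathcal{P}$. $\chi_{\rm DP}(G:\mathcal{P})$ is the least integer $k\ge 0$ such that every $k$-cover of $G$ has a $\mathcal{P}$-transversal. $G$ is $(\mathcal{P},\chi_{\rm DP})$-critical if every proper induced subgraph $G'$ of $G$ satisfies $\chi_{\rm DP}(G':\mathcal{P})<\chi_{\rm DP}(G:\mathcal{P})$.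 -}

module Defs where

open import Data.Bool using (Bool; T)
open import Data.Fin using (Fin; zero; suc; splitAt)
import Data.Fin as Fin
open import Data.Fin.Permutation using (Permutation; _⟨$⟩ʳ_)
open import Data.Fin.Subset using (Subset; inside; outside; ∣_∣; _∈_; _∩_; Empty; ⊤)
open import Data.Nat using (ℕ; _+_; _≤_; _<_)
open import Data.Product using (Σ-syntax; ∃-syntax; _×_)
open import Data.Sum using (_⊎_; inj₁; inj₂)
open import Data.Vec using (_∷_)
open import Function using (_⇔_)
open import Level using (Level) renaming (suc to lsuc)
open import Relation.Binary.Definitions using (_Respects_)
open import Relation.Binary.PropositionalEquality using (_≡_; _≢_; refl)
open import Relation.Nullary using (¬_)

private
  variable
    ℓ : Level

-- A finite loopless multigraph, with vertex set {0, …, order - 1} and given by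
-- the number of edges joining each pair of vertices.
record Graph : Set where
  field
    order     : ℕ
    mult      : Fin order → Fin order → ℕ
    symmetric : ∀ u v → mult u v ≡ mult v u
    loopless  : ∀ v → mult v v ≡ 0

open Graph public

Vertex : Graph → Set
Vertex G = Fin (order G)

-- Parallel edges are told apart by their labels.  Since edges are undirected,
-- each one is represented once, with its smaller end first.
record Edge (G : Graph) : Set where
  field
    end₁ end₂ : Vertex G
    ordered   : end₁ Fin.< end₂
    label     : Fin (mult G end₁ end₂)

open Edge public

Incident : {G : Graph} → Edge G → Vertex G → Set
Incident e v = end₁ e ≡ v ⊎ end₂ e ≡ v

Joins : {G : Graph} → Edge G → Subset (order G) → Subset (order G) → Set
Joins e A B = (end₁ e ∈ A × end₂ e ∈ B) ⊎ (end₁ e ∈ B × end₂ e ∈ A)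

EdgeSet : Graph → Set
EdgeSet G = Edge G → Bool

_∈ᴱ_ : {G : Graph} → Edge G → EdgeSet G → Set
e ∈ᴱ M = T (M e)

IsMatching : {G : Graph} → EdgeSet G → Set
IsMatching M = ∀ e f v → e ∈ᴱ M → f ∈ᴱ M → Incident e v → Incident f v → e ≡ f

Independent : (G : Graph) → Subset (order G) → Set
Independent G A = ∀ {x y} → x ∈ A → y ∈ A → mult G x y ≡ 0

-- The increasing enumeration of the elements of a subset.
enum : ∀ {n} (S : Subset n) → Fin ∣ S ∣ → Fin n
enum (inside  ∷ S) zero    = zero
enum (inside  ∷ S) (suc i) = suc (enum S i)
enum (outside ∷ S) i       = suc (enum S i)

-- The subgraph induced by S, with its vertices renumbered.
infixl 8 _[_]
_[_] : (G : Graph) → Subset (order G) → Graph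
G [ S ] = record
  { order     = ∣ S ∣
  ; mult      = λ i j → mult G (enum S i) (enum S j)
  ; symmetric = λ i j → symmetric G (enum S i) (enum S j)
  ; loopless  = λ i → loopless G (enum S i)
  }

infix 4 _≅_
_≅_ : Graph → Graph → Set
G ≅ H = Σ[ π ∈ Permutation (order G) (order H) ]
          (∀ u v → mult H (π ⟨$⟩ʳ u) (π ⟨$⟩ʳ v) ≡ mult G u v)

infixr 6 _⊕_
_⊕_ : Graph → Graph → Graph
G ⊕ H = record
  { order     = order G + order H
  ; mult      = λ x y → m (splitAt (order G) x) (splitAt (order G) y)
  ; symmetric = λ x y → m-sym (splitAt (order G) x) (splitAt (order G) y)
  ; loopless  = λ x → m-loopless (splitAt (order G) x)
  }
  where
  m : Vertex G ⊎ Vertex H → Vertex G ⊎ Vertex H → ℕ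
  m (inj₁ u) (inj₁ v) = mult G u v
  m (inj₂ u) (inj₂ v) = mult H u v
  m (inj₁ _) (inj₂ _) = 0
  m (inj₂ _) (inj₁ _) = 0

  m-sym : ∀ x y → m x y ≡ m y x
  m-sym (inj₁ u) (inj₁ v) = symmetric G u v
  m-sym (inj₂ u) (inj₂ v) = symmetric H u v
  m-sym (inj₁ _) (inj₂ _) = refl
  m-sym (inj₂ _) (inj₁ _) = refl

  m-loopless : ∀ x → m x x ≡ 0
  m-loopless (inj₁ v) = loopless G v
  m-loopless (inj₂ v) = loopless H v

record GraphProperty (ℓ : Level) : Set (lsuc ℓ) where
  field
    Holds    : Graph → Set ℓ
    respects : Holds Respects _≅_

open GraphProperty public

NonTrivial : GraphProperty ℓ → Set ℓ
NonTrivial P = (∃[ G ] (0 < order G × Holds P G)) × ¬ (∀ G → Holds P G)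

Hereditary : GraphProperty ℓ → Set ℓ
Hereditary P = ∀ G (S : Subset (order G)) → Holds P G → Holds P (G [ S ])

Additive : GraphProperty ℓ → Set ℓ
Additive P = ∀ G H → Holds P G → Holds P H → Holds P (G ⊕ H)

record Reliable (P : GraphProperty ℓ) : Set ℓ where
  field
    nonTrivial : NonTrivial P
    hereditary : Hereditary P
    additive   : Additive P

record Cover (G : Graph) : Set where
  field
    H           : Graph
    X           : Vertex G → Subset (order H)
    disjoint    : ∀ {u v} → u ≢ v → Empty (X u ∩ X v)
    covering    : ∀ x → ∃[ v ] x ∈ X v
    independent : ∀ v → Independent H (X v)
    matchings   : ∀ {u v} → u ≢ v →
      Σ[ M ∈ (Fin (mult G u v) → EdgeSet H) ]
        (∀ i → IsMatching (M i)) ×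
        (∀ e → Joins e (X u) (X v) ⇔ (∃[ i ] e ∈ᴱ M i))

IsKCover : {G : Graph} → ℕ → Cover G → Set
IsKCover k C = ∀ v → k ≤ ∣ Cover.X C v ∣

IsTransversal : {G : Graph} (C : Cover G) → Subset (order (Cover.H C)) → Set
IsTransversal C S = ∀ v → ∣ S ∩ Cover.X C v ∣ ≡ 1

HasPropTransversal : {G : Graph} → GraphProperty ℓ → Cover G → Set ℓ
HasPropTransversal P C = ∃[ S ] (IsTransversal C S × Holds P (Cover.H C [ S ]))

DPColorable : GraphProperty ℓ → Graph → ℕ → Set ℓ
DPColorable P G k = (C : Cover G) → IsKCover k C → HasPropTransversal P C

-- χ_DP(G : P) as the graph of a partial function: "χ_DP(G : P) exists and
-- equals k".  A least such k is unique by antisymmetry of _≤_.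
IsχDP : GraphProperty ℓ → Graph → ℕ → Set ℓ
IsχDP P G k = DPColorable P G k × (∀ j → DPColorable P G j → k ≤ j)

χDP-equal : GraphProperty ℓ → Graph → Graph → Set ℓ
χDP-equal P G G′ = ∃[ k ] (IsχDP P G k × IsχDP P G′ k)

χDP-less : GraphProperty ℓ → Graph → Graph → Set ℓ
χDP-less P G G′ = ∃[ j ] ∃[ k ] (IsχDP P G j × IsχDP P G′ k × j < k)

Critical : GraphProperty ℓ → Graph → Set ℓ
Critical P G = ∀ (S : Subset (order G)) → S ≢ ⊤ → χDP-less P (G [ S ]) G

{-# OPTIONS --safe #-}
module Submission where

-- χ_DP is finite: if the X_v are large compared with the order and the
-- multiplicities of G, a greedy choice gives an independent transversal T, and
-- H[T] is edgeless, hence in P.  χ_DP is monotone under induced subgraphs: a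
-- k-cover of G[S] extends to a k-cover of G by k isolated vertices for each
-- v ∉ S, and P-transversals restrict because P is hereditary.  A smallest S with
-- χ_DP(G[S]) = χ_DP(G) is therefore critical.  Embeddings take the place of
-- inclusions, so that nested induced subgraphs need no renumbering.

open import Defs
open import Axiom.ExcludedMiddle using (ExcludedMiddle)
open import Data.Bool using (false)
open import Data.Empty using (⊥)
open import Data.Fin
  using (Fin; zero; suc; toℕ; cast; splitAt; _↑ˡ_; _↑ʳ_; combine; remQuot; inject≤)
import Data.Fin as Fin
open import Data.Fin.Permutation using (permutation)
import Data.Fin.Properties as Fin
open import Data.Fin.Subset using (Subset; inside; outside; ∣_∣; _∈_; _∩_; ∁; ⊤)
open import Data.Fin.Subset.Properties
  using (_∈?_; x∈p∩q⁺; x∈p∩q⁻; x∈p⇒x∉∁p; x∉p⇒x∈∁p; ∣p∣≤n; ∣p∣≡n⇒p≡⊤; ∈⊤)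
open import Data.Nat using (ℕ; zero; suc; _+_; _*_; _≤_; _<_; _⊔_)
open import Data.Nat.Induction using (<-rec)
import Data.Nat.Properties as ℕ
open import Data.Product using (Σ-syntax; ∃-syntax; _×_; _,_; proj₁; proj₂)
open import Data.Sum using (_⊎_; inj₁; inj₂; [_,_]′)
open import Data.Vec using (_∷_; here; there; tabulate)
open import Data.Vec.Properties using (lookup⇒[]=; []=⇒lookup; lookup∘tabulate)
open import Function using (_∘_; _⇔_; mk⇔; id; Injective; Equivalence)
open import Level using (Level)
open import Relation.Binary.Definitions using (tri<; tri≈; tri>)
open import Relation.Binary.PropositionalEquality hiding ([_])
open import Relation.Nullary using (¬_; yes; no; does; contradiction)
open import Relation.Nullary.Decidable using (dec-true; decidable-stable)
open import Relation.Unary using (Pred; Decidable)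

private
  variable
    ℓ : Level
    m n k q : ℕ

-- Finite subsets

select : {Q : Pred (Fin n) ℓ} → Decidable Q → Subset n
select Q? = tabulate (does ∘ Q?)

∈-select⁺ : {Q : Pred (Fin n) ℓ} (Q? : Decidable Q) {x : Fin n} → Q x → x ∈ select Q?
∈-select⁺ Q? {x} qx =
  lookup⇒[]= x _ (trans (lookup∘tabulate (does ∘ Q?) x) (dec-true (Q? x) qx))

∈-select⁻ : {Q : Pred (Fin n) ℓ} (Q? : Decidable Q) {x : Fin n} → x ∈ select Q? → Q x
∈-select⁻ Q? {x} x∈ with Q? x | trans (sym (lookup∘tabulate (does ∘ Q?) x)) ([]=⇒lookup x∈)
... | yes qx | _  = qx
... | no _   | ()

image? : (f : Fin m → Fin n) → Decidable (λ x → ∃[ i ] f i ≡ x)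
image? f x = Fin.any? (λ i → f i Fin.≟ x)

image : (Fin m → Fin n) → Subset n
image f = select (image? f)

enum-∈ : (S : Subset n) (i : Fin ∣ S ∣) → enum S i ∈ S
enum-∈ (inside  ∷ S) zero    = here
enum-∈ (inside  ∷ S) (suc i) = there (enum-∈ S i)
enum-∈ (outside ∷ S) i       = there (enum-∈ S i)

enum-injective : (S : Subset n) → Injective _≡_ _≡_ (enum S)
enum-injective (inside  ∷ S) {zero}  {zero}  _  = refl
enum-injective (inside  ∷ S) {suc i} {suc j} eq =
  cong suc (enum-injective S (Fin.suc-injective eq))
enum-injective (outside ∷ S) eq = enum-injective S (Fin.suc-injective eq)

enum-surjective : (S : Subset n) {x : Fin n} → x ∈ S → ∃[ i ] enum S i ≡ x
enum-surjective (inside ∷ S) here = zero , refl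
enum-surjective (inside ∷ S) (there x∈S) with i , eq ← enum-surjective S x∈S = suc i , cong suc eq
enum-surjective (outside ∷ S) (there x∈S) with i , eq ← enum-surjective S x∈S = i , cong suc eq

index : (S : Subset n) {x : Fin n} → x ∈ S → Fin ∣ S ∣
index S = proj₁ ∘ enum-surjective S

enum-index : (S : Subset n) {x : Fin n} (x∈S : x ∈ S) → enum S (index S x∈S) ≡ x
enum-index S = proj₂ ∘ enum-surjective S

index-injective : (S : Subset n) {x y : Fin n} (x∈S : x ∈ S) (y∈S : y ∈ S) →
  index S x∈S ≡ index S y∈S → x ≡ y
index-injective S x∈S y∈S eq =
  trans (sym (enum-index S x∈S)) (trans (cong (enum S) eq) (enum-index S y∈S))

injective⇒≤∣∣ : (S : Subset n) {f : Fin m → Fin n} → Injective _≡_ _≡_ f →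
  (∀ i → f i ∈ S) → m ≤ ∣ S ∣
injective⇒≤∣∣ S f-inj f∈S = Fin.injective⇒≤ λ {i} {j} eq →
  f-inj (index-injective S (f∈S i) (f∈S j) eq)

unique⇒∣∣≡1 : (S : Subset n) {x : Fin n} → x ∈ S → (∀ {y} → y ∈ S → y ≡ x) → ∣ S ∣ ≡ 1
unique⇒∣∣≡1 S {x} x∈S unique = ℕ.≤-antisym
  (Fin.injective⇒≤ {f = λ _ → zero {0}} λ {i} {j} _ → enum-injective S
    (trans (unique (enum-∈ S i)) (sym (unique (enum-∈ S j)))))
  (injective⇒≤∣∣ S {f = λ (_ : Fin 1) → x} (λ { {zero} {zero} _ → refl }) (λ _ → x∈S))

∣∣≡1⇒∃ : (S : Subset n) → ∣ S ∣ ≡ 1 → ∃[ x ] x ∈ S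
∣∣≡1⇒∃ S eq = enum S i , enum-∈ S i
  where i = cast (sym eq) zero

∣∣≡1⇒unique : (S : Subset n) → ∣ S ∣ ≡ 1 → ∀ {x y} → x ∈ S → y ∈ S → x ≡ y
∣∣≡1⇒unique S eq x∈S y∈S = index-injective S x∈S y∈S (all-equal eq _ _)
  where
  all-equal : m ≡ 1 → (i j : Fin m) → i ≡ j
  all-equal refl zero zero = refl

-- Embeddings onto induced subgraphs

infix 4 _↪_
record _↪_ (G H : Graph) : Set where
  field
    fun       : Vertex G → Vertex H
    injective : Injective _≡_ _≡_ fun
    preserves : ∀ u v → mult H (fun u) (fun v) ≡ mult G u v

open _↪_

↪-refl : ∀ {G} → G ↪ G
↪-refl = record { fun = id ; injective = id ; preserves = λ _ _ → refl }

↪-trans : ∀ {G H K} → G ↪ H → H ↪ K → G ↪ K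
↪-trans f g = record
  { fun       = fun g ∘ fun f
  ; injective = injective f ∘ injective g
  ; preserves = λ u v → trans (preserves g _ _) (preserves f u v)
  }

[]-↪ : ∀ G (S : Subset (order G)) → G [ S ] ↪ G
[]-↪ G S = record
  { fun = enum S ; injective = enum-injective S ; preserves = λ _ _ → refl }

restrict : ∀ {G H} (f : G ↪ H) (S : Subset (order H)) → (∀ v → fun f v ∈ S) → G ↪ H [ S ]
restrict {H = H} f S f∈S = record
  { fun       = λ v → index S (f∈S v)
  ; injective = λ {u} {v} eq → injective f (index-injective S (f∈S u) (f∈S v) eq)
  ; preserves = λ u v →
      trans (cong₂ (mult H) (enum-index S (f∈S u)) (enum-index S (f∈S v))) (preserves f u v)
  }

module _ {G H : Graph} (f : G ↪ H) where

  private
    S = image (fun f)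

    f∈S : ∀ v → fun f v ∈ S
    f∈S v = ∈-select⁺ (image? (fun f)) (v , refl)

    preimage : ∀ i → ∃[ v ] fun f v ≡ enum S i
    preimage i = ∈-select⁻ (image? (fun f)) (enum-∈ S i)

  ↪-image : G ↪ H [ S ]
  ↪-image = restrict f S f∈S

  image-↪ : H [ S ] ↪ G
  image-↪ = record
    { fun       = proj₁ ∘ preimage
    ; injective = λ {i} {j} eq → enum-injective S
        (trans (sym (proj₂ (preimage i))) (trans (cong (fun f) eq) (proj₂ (preimage j))))
    ; preserves = λ i j → trans (sym (preserves f _ _))
        (cong₂ (mult H) (proj₂ (preimage i)) (proj₂ (preimage j)))
    }

  image-≅ : H [ S ] ≅ G
  image-≅ = permutation (fun image-↪) (fun ↪-image)
      (λ v → injective f (trans (proj₂ (preimage _)) (enum-index S (f∈S v))))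
      (λ i → enum-injective S (trans (enum-index S (f∈S _)) (proj₂ (preimage i))))
    , preserves image-↪

Holds-↪ : (P : GraphProperty ℓ) → Hereditary P → ∀ {G H} → G ↪ H → Holds P H → Holds P G
Holds-↪ P hereditary f = respects P (image-≅ f) ∘ hereditary _ (image (fun f))

edgeless : ℕ → Graph
edgeless n = record
  { order = n ; mult = λ _ _ → 0 ; symmetric = λ _ _ → refl ; loopless = λ _ → refl }

⊕-edgeless-↪ : ∀ m n → edgeless (m + n) ↪ edgeless m ⊕ edgeless n
⊕-edgeless-↪ m n = record { fun = id ; injective = id ; preserves = nonadjacent }
  where
  nonadjacent : ∀ x y → mult (edgeless m ⊕ edgeless n) x y ≡ 0
  nonadjacent x y with splitAt m x | splitAt m y
  ... | inj₁ _ | inj₁ _ = refl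
  ... | inj₁ _ | inj₂ _ = refl
  ... | inj₂ _ | inj₁ _ = refl
  ... | inj₂ _ | inj₂ _ = refl

edgeless-holds : (P : GraphProperty ℓ) → Reliable P → ∀ n → Holds P (edgeless n)
edgeless-holds P reliable = holds
  where
  open Reliable reliable
  G₀ = proj₁ (proj₁ nonTrivial)
  0<G₀ = proj₁ (proj₂ (proj₁ nonTrivial))
  G₀-holds = proj₂ (proj₂ (proj₁ nonTrivial))

  holds : ∀ n → Holds P (edgeless n)
  holds zero = Holds-↪ P hereditary f G₀-holds
    where
    f : edgeless 0 ↪ G₀
    f = record { fun = λ () ; injective = λ { {()} } ; preserves = λ () }
  holds (suc n) = Holds-↪ P hereditary (⊕-edgeless-↪ 1 n)
    (additive _ _ (Holds-↪ P hereditary f G₀-holds) (holds n))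
    where
    f : edgeless 1 ↪ G₀
    f = record
      { fun       = λ _ → Fin.fromℕ< 0<G₀
      ; injective = λ { {zero} {zero} _ → refl }
      ; preserves = λ _ _ → loopless G₀ _
      }

-- Edges and covers

edge-≡ : ∀ {G} {e f : Edge G} → end₁ e ≡ end₁ f → end₂ e ≡ end₂ f →
  toℕ (label e) ≡ toℕ (label f) → e ≡ f
edge-≡ {G} {e} {f} refl refl eq
  with refl ← Fin.toℕ-injective eq
  with refl ← Fin.<-irrelevant (ordered e) (ordered f) = refl

⊕-↑ˡ-preserves : ∀ G H u v → mult (G ⊕ H) (u ↑ˡ order H) (v ↑ˡ order H) ≡ mult G u v
⊕-↑ˡ-preserves G H u v
  rewrite Fin.splitAt-↑ˡ (order G) u (order H) | Fin.splitAt-↑ˡ (order G) v (order H) = refl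

↑ˡ-↪ : ∀ G H → G ↪ G ⊕ H
↑ˡ-↪ G H = record
  { fun = _↑ˡ order H ; injective = Fin.↑ˡ-injective _ _ _ ; preserves = ⊕-↑ˡ-preserves G H }

record Restricts (G : Graph) (e : Edge (G ⊕ edgeless q)) : Set where
  field
    edge   : Edge G
    end₁-≡ : end₁ edge ↑ˡ q ≡ end₁ e
    end₂-≡ : end₂ edge ↑ˡ q ≡ end₂ e
    label-≡ : toℕ (label edge) ≡ toℕ (label e)

⊕-edgeless-adjacent : ∀ G x y → mult (G ⊕ edgeless q) x y ≢ 0 →
  (∃[ u ] u ↑ˡ q ≡ x) × (∃[ v ] v ↑ˡ q ≡ y)
⊕-edgeless-adjacent G x y adjacent with splitAt (order G) x in eqx | splitAt (order G) y in eqy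
... | inj₁ u | inj₁ v = (u , Fin.splitAt⁻¹-↑ˡ eqx) , (v , Fin.splitAt⁻¹-↑ˡ eqy)
... | inj₁ _ | inj₂ _ = contradiction refl adjacent
... | inj₂ _ | inj₁ _ = contradiction refl adjacent
... | inj₂ _ | inj₂ _ = contradiction refl adjacent

restrictEdge : ∀ G (e : Edge (G ⊕ edgeless q)) → Restricts G e
restrictEdge {q} G record { end₁ = x ; end₂ = y ; ordered = x<y ; label = l }
  with (u , refl) , (v , refl) ← ⊕-edgeless-adjacent G x y (λ eq → Fin.¬Fin0 (subst Fin eq l)) = record
  { edge = record
    { end₁    = u
    ; end₂    = v
    ; ordered = subst₂ _<_ (Fin.toℕ-↑ˡ u q) (Fin.toℕ-↑ˡ v q) x<y
    ; label   = cast (⊕-↑ˡ-preserves G (edgeless q) u v) l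
    }
  ; end₁-≡  = refl
  ; end₂-≡  = refl
  ; label-≡ = Fin.toℕ-cast _ l
  }

restrictEdge-injective : ∀ G (e f : Edge (G ⊕ edgeless q)) →
  Restricts.edge (restrictEdge G e) ≡ Restricts.edge (restrictEdge G f) → e ≡ f
restrictEdge-injective {q} G e f eq = edge-≡
  (trans (sym E.end₁-≡) (trans (cong (λ e → end₁ e ↑ˡ q) eq) F.end₁-≡))
  (trans (sym E.end₂-≡) (trans (cong (λ e → end₂ e ↑ˡ q) eq) F.end₂-≡))
  (trans (sym E.label-≡) (trans (cong (λ e → toℕ (label e)) eq) F.label-≡))
  where
  module E = Restricts (restrictEdge G e)
  module F = Restricts (restrictEdge G f)

module _ {G : Graph} (C : Cover G) where
  open Cover C

  home : Vertex H → Vertex G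
  home = proj₁ ∘ covering

  home-∈ : ∀ x → x ∈ X (home x)
  home-∈ = proj₂ ∘ covering

  ∈⇒home : ∀ {v x} → x ∈ X v → home x ≡ v
  ∈⇒home {v} {x} x∈ = decidable-stable (home x Fin.≟ v) λ home≢v →
    disjoint home≢v (x , x∈p∩q⁺ (home-∈ x , x∈))

-- A cover of G is extended along G ↪ K by giving every vertex of K outside the
-- image of G its own k isolated vertices.
module Extension {G K : Graph} (f : G ↪ K) (k : ℕ) (C : Cover G) where
  open Cover C renaming (H to H₀; X to X₀)

  new : Subset (order K)
  new = ∁ (image (fun f))

  new-≢ : ∀ i u → enum new i ≢ fun f u
  new-≢ i u eq = x∈p⇒x∉∁p (∈-select⁺ (image? (fun f)) (u , sym eq)) (enum-∈ new i)

  pad : ℕ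
  pad = ∣ new ∣ * k

  H : Graph
  H = H₀ ⊕ edgeless pad

  assign : Vertex H₀ ⊎ Fin pad → Vertex K
  assign = [ fun f ∘ home C , enum new ∘ proj₁ ∘ remQuot k ]′

  home′ : Vertex H → Vertex K
  home′ = assign ∘ splitAt (order H₀)

  home′-↑ˡ : ∀ x → home′ (x ↑ˡ pad) ≡ fun f (home C x)
  home′-↑ˡ x = cong assign (Fin.splitAt-↑ˡ (order H₀) x pad)

  home′-↑ʳ : ∀ i j → home′ (order H₀ ↑ʳ combine i j) ≡ enum new i
  home′-↑ʳ i j = trans (cong assign (Fin.splitAt-↑ʳ (order H₀) pad (combine i j)))
    (cong (enum new ∘ proj₁) (Fin.remQuot-combine i j))

  home′-old : ∀ x {u} → home′ x ≡ fun f u → ∃[ y ] y ↑ˡ pad ≡ x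
  home′-old x {u} eq with splitAt (order H₀) x in split
  ... | inj₁ y = y , Fin.splitAt⁻¹-↑ˡ split
  ... | inj₂ j = contradiction eq (new-≢ _ u)

  X? : ∀ v → Decidable (λ x → home′ x ≡ v)
  X? v x = home′ x Fin.≟ v

  X : Vertex K → Subset (order H)
  X v = select (X? v)

  ∈X⁺ : ∀ {x u} → x ∈ X₀ u → x ↑ˡ pad ∈ X (fun f u)
  ∈X⁺ {x} {u} x∈ = ∈-select⁺ (X? _) (trans (home′-↑ˡ x) (cong (fun f) (∈⇒home C x∈)))

  ∈X⁻ : ∀ {x v} → x ↑ˡ pad ∈ X v → fun f (home C x) ≡ v
  ∈X⁻ {x} x∈ = trans (sym (home′-↑ˡ x)) (∈-select⁻ (X? _) x∈)

  ∈X-fun⁻ : ∀ {x u} → x ↑ˡ pad ∈ X (fun f u) → x ∈ X₀ u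
  ∈X-fun⁻ {x} x∈ = subst (λ v → x ∈ X₀ v) (injective f (∈X⁻ x∈)) (home-∈ C x)

  old : Edge H → Edge H₀
  old = Restricts.edge ∘ restrictEdge H₀

  end₁-old : ∀ e → end₁ (old e) ↑ˡ pad ≡ end₁ e
  end₁-old = Restricts.end₁-≡ ∘ restrictEdge H₀

  end₂-old : ∀ e → end₂ (old e) ↑ˡ pad ≡ end₂ e
  end₂-old = Restricts.end₂-≡ ∘ restrictEdge H₀

  incident-old : ∀ e v → Incident e v → ∃[ u ] u ↑ˡ pad ≡ v
  incident-old e v (inj₁ refl) = _ , end₁-old e
  incident-old e v (inj₂ refl) = _ , end₂-old e

  incident⁻ : ∀ e u → Incident e (u ↑ˡ pad) → Incident (old e) u
  incident⁻ e u (inj₁ eq) = inj₁ (Fin.↑ˡ-injective pad _ _ (trans (end₁-old e) eq))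
  incident⁻ e u (inj₂ eq) = inj₂ (Fin.↑ˡ-injective pad _ _ (trans (end₂-old e) eq))

  joins⁺ : ∀ e {u v} → Joins (old e) (X₀ u) (X₀ v) → Joins e (X (fun f u)) (X (fun f v))
  joins⁺ e {u} {v} = subst₂ (λ x y → Joins (old e) (X₀ u) (X₀ v) →
      (x ∈ X (fun f u) × y ∈ X (fun f v)) ⊎ (x ∈ X (fun f v) × y ∈ X (fun f u)))
    (end₁-old e) (end₂-old e)
    λ { (inj₁ (x∈ , y∈)) → inj₁ (∈X⁺ x∈ , ∈X⁺ y∈)
      ; (inj₂ (x∈ , y∈)) → inj₂ (∈X⁺ x∈ , ∈X⁺ y∈) }

  joins-↑ˡ : ∀ e {u v} → Joins e (X u) (X v) →
    (end₁ (old e) ↑ˡ pad ∈ X u × end₂ (old e) ↑ˡ pad ∈ X v) ⊎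
    (end₁ (old e) ↑ˡ pad ∈ X v × end₂ (old e) ↑ˡ pad ∈ X u)
  joins-↑ˡ e {u} {v} = subst₂
    (λ x y → (x ∈ X u × y ∈ X v) ⊎ (x ∈ X v × y ∈ X u))
    (sym (end₁-old e)) (sym (end₂-old e))

  joins⁻ : ∀ e {u v} → Joins e (X (fun f u)) (X (fun f v)) → Joins (old e) (X₀ u) (X₀ v)
  joins⁻ e joins with joins-↑ˡ e joins
  ... | inj₁ (x∈ , y∈) = inj₁ (∈X-fun⁻ x∈ , ∈X-fun⁻ y∈)
  ... | inj₂ (x∈ , y∈) = inj₂ (∈X-fun⁻ x∈ , ∈X-fun⁻ y∈)

  joins-image : ∀ e {u v} → Joins e (X u) (X v) → (∃[ a ] fun f a ≡ u) × (∃[ b ] fun f b ≡ v)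
  joins-image e joins with joins-↑ˡ e joins
  ... | inj₁ (x∈ , y∈) = (_ , ∈X⁻ x∈) , (_ , ∈X⁻ y∈)
  ... | inj₂ (x∈ , y∈) = (_ , ∈X⁻ y∈) , (_ , ∈X⁻ x∈)

  Matchings : Vertex K → Vertex K → Set
  Matchings u v = Σ[ M ∈ (Fin (mult K u v) → EdgeSet H) ]
    (∀ i → IsMatching (M i)) × (∀ e → Joins e (X u) (X v) ⇔ (∃[ i ] e ∈ᴱ M i))

  no-matchings : ∀ {u v} → (∀ e → ¬ Joins e (X u) (X v)) → Matchings u v
  no-matchings unjoined =
    (λ _ _ → false) , (λ _ _ _ _ ()) , λ e → mk⇔ (λ joins → contradiction joins (unjoined e)) λ ()

  old-matchings : ∀ {a b} → a ≢ b → Matchings (fun f a) (fun f b)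
  old-matchings {a} {b} a≢b with M , matching , union ← matchings a≢b =
      (λ i e → M (cast p i) (old e))
    , (λ i → matching′ (matching (cast p i)))
    , λ e → let module U = Equivalence (union (old e)) in mk⇔
        (λ joins → let i , e∈ = U.to (joins⁻ e joins) in
          cast (sym p) i , subst (λ j → old e ∈ᴱ M j) (sym (Fin.cast-involutive p (sym p) i)) e∈)
        (λ (i , e∈) → joins⁺ e (U.from (cast p i , e∈)))
    where
    p = preserves f a b
    matching′ : ∀ {M : EdgeSet H₀} → IsMatching M → IsMatching {H} (M ∘ old)
    matching′ matching e e′ v e∈ e′∈ ev e′v with u , refl ← incident-old e v ev =
      restrictEdge-injective H₀ e e′
        (matching _ _ u e∈ e′∈ (incident⁻ e u ev) (incident⁻ e′ u e′v))

  matchings′ : ∀ {u v} → u ≢ v → Matchings u v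
  matchings′ {u} {v} u≢v with image? (fun f) u | image? (fun f) v
  ... | yes (a , refl) | yes (b , refl) = old-matchings (u≢v ∘ cong (fun f))
  ... | no u∉ | _ = no-matchings λ e → u∉ ∘ proj₁ ∘ joins-image e
  ... | yes _ | no v∉ = no-matchings λ e → v∉ ∘ proj₂ ∘ joins-image e

  independent′ : ∀ v → Independent H (X v)
  independent′ v {x} {y} x∈ y∈ = decidable-stable (mult H x y ℕ.≟ 0) λ adjacent →
    nonadjacent (⊕-edgeless-adjacent H₀ x y adjacent) x∈ y∈ adjacent
    where
    nonadjacent : ∀ {x y} → (∃[ a ] a ↑ˡ pad ≡ x) × (∃[ b ] b ↑ˡ pad ≡ y) →
      x ∈ X v → y ∈ X v → mult H x y ≢ 0 → ⊥
    nonadjacent ((a , refl) , (b , refl)) a∈ b∈ adjacent with refl ← ∈X⁻ a∈ =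
      adjacent (trans (⊕-↑ˡ-preserves H₀ (edgeless pad) a b)
        (independent (home C a) (home-∈ C a) (∈X-fun⁻ b∈)))

  extension : Cover K
  extension = record
    { H = H
    ; X = X
    ; disjoint = λ { {u} {v} u≢v (x , x∈) → let x∈u , x∈v = x∈p∩q⁻ (X u) (X v) x∈ in
        u≢v (trans (sym (∈-select⁻ (X? u) x∈u)) (∈-select⁻ (X? v) x∈v)) }
    ; covering = λ x → home′ x , ∈-select⁺ (X? _) refl
    ; independent = independent′
    ; matchings = matchings′
    }

  extension-isKCover : IsKCover k C → IsKCover k extension
  extension-isKCover kCover v with image? (fun f) v
  ... | yes (u , refl) = ℕ.≤-trans (kCover u) (injective⇒≤∣∣ (X v)
    (λ eq → enum-injective (X₀ u) (Fin.↑ˡ-injective pad _ _ eq))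
    (λ i → ∈X⁺ (enum-∈ (X₀ u) i)))
  ... | no v∉ = injective⇒≤∣∣ (X v) {f = λ j → order H₀ ↑ʳ combine i j}
    (λ eq → Fin.combine-injectiveʳ i _ i _ (Fin.↑ʳ-injective (order H₀) _ _ eq))
    (λ j → ∈-select⁺ (X? v) (trans (home′-↑ʳ i j) (enum-index new v∈)))
    where
    v∈ = x∉p⇒x∈∁p (v∉ ∘ ∈-select⁻ (image? (fun f)))
    i = index new v∈

  module _ (T : Subset (order H)) (T-transversal : IsTransversal extension T) where

    in-T? : Decidable (λ x → x ↑ˡ pad ∈ T)
    in-T? x = (x ↑ˡ pad) ∈? T

    T₀ : Subset (order H₀)
    T₀ = select in-T?

    T₀-transversal : IsTransversal C T₀
    T₀-transversal u with x , x∈ ← ∣∣≡1⇒∃ _ (T-transversal (fun f u))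
      with x∈T , x∈X ← x∈p∩q⁻ T (X (fun f u)) x∈
      with y , refl ← home′-old x (∈-select⁻ (X? _) x∈X) = unique⇒∣∣≡1 (T₀ ∩ X₀ u)
        (x∈p∩q⁺ (∈-select⁺ in-T? x∈T , ∈X-fun⁻ x∈X))
        λ z∈ → let z∈T , z∈X = x∈p∩q⁻ T₀ (X₀ u) z∈ in
          Fin.↑ˡ-injective pad _ _ (∣∣≡1⇒unique _ (T-transversal (fun f u))
            (x∈p∩q⁺ (∈-select⁻ in-T? z∈T , ∈X⁺ z∈X)) x∈)

    T₀-↪ : H₀ [ T₀ ] ↪ H [ T ]
    T₀-↪ = restrict (↪-trans ([]-↪ H₀ T₀) (↑ˡ-↪ H₀ (edgeless pad))) T
      λ i → ∈-select⁻ in-T? (enum-∈ T₀ i)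

DPColorable-↪ : (P : GraphProperty ℓ) → Hereditary P → ∀ {G K} → G ↪ K →
  DPColorable P K k → DPColorable P G k
DPColorable-↪ {k = k} P hereditary f colorable C kCover =
  let open Extension f k C
      T , transversal , holds = colorable extension (extension-isKCover kCover)
  in T₀ T transversal , T₀-transversal T transversal , Holds-↪ P hereditary (T₀-↪ T transversal) holds

-- Independent transversals

Ends : ∀ {G} → Edge G → Vertex G → Vertex G → Set
Ends e x y = (end₁ e ≡ x × end₂ e ≡ y) ⊎ (end₁ e ≡ y × end₂ e ≡ x)

adjacent⇒edge : ∀ G x y → mult G x y ≢ 0 → ∃[ e ] Ends {G} e x y
adjacent⇒edge G x y adjacent with Fin.<-cmp x y
... | tri< x<y _ _ = record
  { end₁ = x ; end₂ = y ; ordered = x<y ; label = Fin.fromℕ< (ℕ.n≢0⇒n>0 adjacent) } , inj₁ (refl , refl)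
... | tri≈ _ refl _ = contradiction (loopless G x) adjacent
... | tri> _ _ y<x = record
  { end₁ = y ; end₂ = x ; ordered = y<x ; label = Fin.fromℕ< (ℕ.n≢0⇒n>0 (adjacent ∘ trans (symmetric G x y))) }
  , inj₂ (refl , refl)

Ends⇒Incident : ∀ {G} {e : Edge G} {x y} → Ends e x y → Incident e y
Ends⇒Incident (inj₁ (_ , eq)) = inj₂ eq
Ends⇒Incident (inj₂ (eq , _)) = inj₁ eq

Ends-unique : ∀ {G} {e : Edge G} {x x′ y} → Ends e x y → Ends e x′ y → x ≡ x′
Ends-unique (inj₁ (refl , refl)) (inj₁ (refl , _))    = refl
Ends-unique (inj₁ (refl , refl)) (inj₂ (eq , refl))   = eq
Ends-unique (inj₂ (refl , refl)) (inj₁ (refl , eq))   = eq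
Ends-unique (inj₂ (refl , refl)) (inj₂ (_ , refl))    = refl

module Greedy {G : Graph} (C : Cover G) (D : ℕ) (mult≤D : ∀ u v → mult G u v ≤ D)
  (large : IsKCover (suc (order G * D)) C) where
  open Cover C

  -- Were every vertex of X v adjacent to some t i, then (u i, matching number)
  -- would determine it, because t i is met at most once by each matching; but
  -- there are at most order G * D such pairs.
  module _ {m} (u : Fin m → Vertex G) (u-inj : Injective _≡_ _≡_ u)
    (v : Vertex G) (u≢v : ∀ i → u i ≢ v)
    (t : Fin m → Vertex H) (t∈X : ∀ i → t i ∈ X (u i)) where

    Blocked : Vertex H → (i : Fin m) → Fin (mult G (u i) v) → Set
    Blocked x i c = ∃[ e ] (Ends {H} e x (t i) × e ∈ᴱ proj₁ (matchings (u≢v i)) c)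

    adjacent⇒blocked : ∀ {x} → x ∈ X v → ∀ i → mult H x (t i) ≢ 0 → ∃[ c ] Blocked x i c
    adjacent⇒blocked {x} x∈X i adjacent with e , ends ← adjacent⇒edge H x (t i) adjacent =
      let c , e∈ = Equivalence.to (proj₂ (proj₂ (matchings (u≢v i))) e) (joins ends)
      in c , e , ends , e∈
      where
      joins : Ends e x (t i) → Joins e (X (u i)) (X v)
      joins (inj₁ (refl , refl)) = inj₂ (x∈X , t∈X i)
      joins (inj₂ (refl , refl)) = inj₁ (t∈X i , x∈X)

    blocked-unique : ∀ {x y i j c d} → Blocked x i c → Blocked y j d →
      u i ≡ u j → toℕ c ≡ toℕ d → x ≡ y
    blocked-unique {i = i} {c = c} (e , ends , e∈) (f , ends′ , f∈) ui≡uj c≡d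
      with refl ← u-inj ui≡uj
      with refl ← Fin.toℕ-injective c≡d
      with refl ← proj₁ (proj₂ (matchings (u≢v i))) c e f (t i) e∈ f∈
                    (Ends⇒Incident {H} {e} ends) (Ends⇒Incident {H} {f} ends′) = Ends-unique {H} {e} ends ends′

    free-vertex : ∃[ x ] (x ∈ X v × ∀ i → mult H x (t i) ≡ 0)
    free-vertex with Fin.any? (λ j → Fin.all? (λ i → mult H (enum (X v) j) (t i) ℕ.≟ 0))
    ... | yes (j , free) = enum (X v) j , enum-∈ (X v) j , free
    ... | no allBlocked = contradiction (Fin.injective⇒≤ code-injective) (ℕ.<⇒≱ (large v))
      where
      blocked : ∀ j → ∃[ i ] ∃[ c ] Blocked (enum (X v) j) i c
      blocked j = let i , adjacent = Fin.¬∀⟶∃¬ m _ (λ i → mult H (enum (X v) j) (t i) ℕ.≟ 0)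
                                       (λ free → allBlocked (j , free))
                  in i , adjacent⇒blocked (enum-∈ (X v) j) i adjacent

      colour : ∀ j → Fin D
      colour j = let i , c , _ = blocked j in inject≤ c (mult≤D (u i) v)

      code : Fin ∣ X v ∣ → Fin (order G * D)
      code j = combine (u (proj₁ (blocked j))) (colour j)

      code-injective : Injective _≡_ _≡_ code
      code-injective {j} {j′} eq =
        let i  , c  , b  = blocked j
            i′ , c′ , b′ = blocked j′
            ui≡ui′ , c≡c′ = Fin.combine-injective (u i) (colour j) (u i′) (colour j′) eq
        in enum-injective (X v) (blocked-unique b b′ ui≡ui′
             (trans (sym (Fin.toℕ-inject≤ c _)) (trans (cong toℕ c≡c′) (Fin.toℕ-inject≤ c′ _))))

  partial : ∀ m (u : Fin m → Vertex G) → Injective _≡_ _≡_ u →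
    Σ[ t ∈ (Fin m → Vertex H) ] (∀ i → t i ∈ X (u i)) × (∀ i j → mult H (t i) (t j) ≡ 0)
  partial zero    u u-inj = (λ ()) , (λ ()) , λ ()
  partial (suc m) u u-inj =
    let t , t∈X , nonadjacent = partial m (u ∘ suc) (Fin.suc-injective ∘ u-inj)
        x , x∈X , free = free-vertex (u ∘ suc) (Fin.suc-injective ∘ u-inj) (u zero)
          (λ i eq → Fin.0≢1+n (sym (u-inj eq))) t t∈X
    in (λ { zero → x ; (suc i) → t i })
     , (λ { zero → x∈X ; (suc i) → t∈X i })
     , λ { zero    zero    → loopless H x
         ; zero    (suc j) → free j
         ; (suc i) zero    → trans (symmetric H (t i) x) (free i)
         ; (suc i) (suc j) → nonadjacent i j }

  independent-transversal : ∃[ T ] (IsTransversal C T × H [ T ] ↪ edgeless ∣ T ∣)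
  independent-transversal with t , t∈X , nonadjacent ← partial (order G) id id =
    image t , transversal , record
      { fun = id ; injective = id ; preserves = λ i j → sym (nonadjacent′ i j) }
    where
    transversal : IsTransversal C (image t)
    transversal v = unique⇒∣∣≡1 (image t ∩ X v)
      (x∈p∩q⁺ (∈-select⁺ (image? t) (v , refl) , t∈X v))
      λ y∈ → let y∈T , y∈X = x∈p∩q⁻ (image t) (X v) y∈
                 u , eq = ∈-select⁻ (image? t) y∈T
             in trans (sym eq) (cong t (trans (sym (∈⇒home C (t∈X u)))
                  (∈⇒home C (subst (_∈ X v) (sym eq) y∈X))))

    nonadjacent′ : ∀ i j → mult H (enum (image t) i) (enum (image t) j) ≡ 0
    nonadjacent′ i j =
      let u , u≡ = ∈-select⁻ (image? t) (enum-∈ (image t) i)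
          v , v≡ = ∈-select⁻ (image? t) (enum-∈ (image t) j)
      in trans (cong₂ (mult H) (sym u≡) (sym v≡)) (nonadjacent u v)

bounded : (f : Fin n → ℕ) → ∃[ b ] (∀ i → f i ≤ b)
bounded {zero}  f = 0 , λ ()
bounded {suc n} f with b , f≤b ← bounded (f ∘ suc) =
  f zero ⊔ b , λ { zero → ℕ.m≤m⊔n (f zero) b ; (suc i) → ℕ.m≤n⇒m≤o⊔n (f zero) (f≤b i) }

DPColorable-exists : (P : GraphProperty ℓ) → Reliable P → ∀ G → ∃[ k ] DPColorable P G k
DPColorable-exists P reliable G = suc (order G * D) , λ C large →
  let T , transversal , f = Greedy.independent-transversal C D mult≤D large
  in T , transversal , Holds-↪ P (Reliable.hereditary reliable) f (edgeless-holds P reliable ∣ T ∣)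
  where
  rows : ∀ u → ∃[ b ] (∀ v → mult G u v ≤ b)
  rows u = bounded (mult G u)

  D = proj₁ (bounded (proj₁ ∘ rows))

  mult≤D : ∀ u v → mult G u v ≤ D
  mult≤D u v = ℕ.≤-trans (proj₂ (rows u) v) (proj₂ (bounded (proj₁ ∘ rows)) u)

-- Critical subgraphs

module _ (em : ExcludedMiddle ℓ) where

  least : (Q : ℕ → Set ℓ) → ∀ k → Q k → ∃[ j ] (Q j × (∀ i → Q i → j ≤ i))
  least Q = <-rec _ search
    where
    search : ∀ k → (∀ {j} → j < k → Q j → ∃[ j ] (Q j × (∀ i → Q i → j ≤ i))) →
      Q k → ∃[ j ] (Q j × (∀ i → Q i → j ≤ i))
    search k rec qk with em {∃[ j ] (j < k × Q j)}
    ... | yes (j , j<k , qj) = rec j<k qj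
    ... | no none = k , qk , λ i qi → ℕ.≮⇒≥ λ i<k → none (i , i<k , qi)

  module _ (P : GraphProperty ℓ) (reliable : Reliable P) where
    open Reliable reliable

    χDP-exists : ∀ G → ∃[ k ] IsχDP P G k
    χDP-exists G = let k , colorable = DPColorable-exists P reliable G
                   in least (DPColorable P G) k colorable

    IsχDP-↪ : ∀ {G K} → G ↪ K → K ↪ G → IsχDP P G k → IsχDP P K k
    IsχDP-↪ f g (colorable , minimal) =
      DPColorable-↪ P hereditary g colorable , λ j → minimal j ∘ DPColorable-↪ P hereditary f

    critical-subgraph : ∀ G {k} → IsχDP P G k → ∀ n (S : Subset (order G)) → ∣ S ∣ ≡ n →
      IsχDP P (G [ S ]) k → Σ[ S ∈ Subset (order G) ] (IsχDP P (G [ S ]) k × Critical P (G [ S ]))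
    critical-subgraph G {k} χ = <-rec _ shrink
      where
      shrink : ∀ n → (∀ {m} → m < n → (S : Subset (order G)) → ∣ S ∣ ≡ m → IsχDP P (G [ S ]) k →
          Σ[ S ∈ Subset (order G) ] (IsχDP P (G [ S ]) k × Critical P (G [ S ]))) →
        (S : Subset (order G)) → ∣ S ∣ ≡ n → IsχDP P (G [ S ]) k →
        Σ[ S ∈ Subset (order G) ] (IsχDP P (G [ S ]) k × Critical P (G [ S ]))
      shrink n rec S refl χS with em {Σ[ R ∈ Subset ∣ S ∣ ] (R ≢ ⊤ × IsχDP P (G [ S ] [ R ]) k)}
      ... | yes (R , R≢⊤ , χR) = rec smaller (image (fun f)) refl (IsχDP-↪ (↪-image f) (image-↪ f) χR)
        where
        f : G [ S ] [ R ] ↪ G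
        f = ↪-trans ([]-↪ (G [ S ]) R) ([]-↪ G S)

        smaller : ∣ image (fun f) ∣ < ∣ S ∣
        smaller = ℕ.≤-<-trans (Fin.injective⇒≤ (injective (image-↪ f)))
          (ℕ.≤∧≢⇒< (∣p∣≤n R) (R≢⊤ ∘ ∣p∣≡n⇒p≡⊤))
      ... | no none = S , χS , λ R R≢⊤ →
        let j , χR = χDP-exists (G [ S ] [ R ])
        in j , k , χR , χS , ℕ.≤∧≢⇒<
          (proj₂ χR k (DPColorable-↪ P hereditary ([]-↪ (G [ S ]) R) (proj₁ χS)))
          λ { refl → none (R , R≢⊤ , χR) }

proposition2 : ∀ {ℓ} → ExcludedMiddle ℓ →
    (P : GraphProperty ℓ) → Reliable P → (G : Graph) →
    Σ[ S ∈ Subset (order G) ] (χDP-equal P (G [ S ]) G × Critical P (G [ S ]))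
proposition2 em P reliable G =
  let k , χ = χDP-exists em P reliable G
      S , χS , critical = critical-subgraph em P reliable G χ _ ⊤ refl
        (IsχDP-↪ em P reliable (restrict (↪-refl {G}) ⊤ (λ _ → ∈⊤)) ([]-↪ G ⊤) χ)
  in S , (k , χS , χ) , critical
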